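{- For any odd prime $p$, any integer $\alpha\ge0$ and any integer $n\ge0$, \[ b_4\!\left(p^{2\alpha+1}n+\frac{(8j+1)p^{2\alpha}-1}{8}\right)\equiv 0 \pmod 2 \] for every integer $j$ with $0\le j\le p-1$ and $\left(\frac{8j+1}{p}\right)=-1$.
   Context: For a positive integer $\ell$, $b_\ell(n)$ denotes the number of partitions of $n$ having no part divisible by $\ell$. $\left(\frac{a}{p}\right)$ is the Legendre symbol. -}

module Defs where

open import Data.Nat.Base
open import Data.Nat.DivMod using (_/_; m/n*n≤m; m*n/n≡m; /-monoˡ-≤)
open import Data.Nat.Divisibility using (_∤_; _∣?_)
open import Data.Nat.ListAction using (sum)
open import Data.Nat.Primality using (Prime; prime⇒nonZero)
open import Data.Nat.Properties
open import Data.Integer.Base as ℤ using (ℤ; +_; 0ℤ; 1ℤ; -1ℤ)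
open import Data.Integer.DivMod as ℤD using (_%ℕ_; _/ℕ_)
import Data.Integer.Divisibility.Signed as ℤ∣
open import Data.Integer.Tactic.RingSolver using (solve-∀)
open import Data.Fin.Base using (toℕ; fromℕ<)
open import Data.Fin.Properties using (any?; toℕ-fromℕ<)
open import Data.List.Base
  using (List; []; _∷_; _++_; map; filter; length; replicate; upTo; concatMap)
open import Data.List.Properties using (∷-injectiveʳ; ++-cancelˡ)
open import Data.List.Membership.Propositional using (_∈_; find; lose)
open import Data.List.Membership.Propositional.Properties
  using (∈-concatMap⁺; ∈-concatMap⁻; ∈-map⁺; ∈-map⁻; ∈-upTo⁺; ∈-upTo⁻; ∈-filter⁺; ∈-filter⁻)
open import Data.List.Relation.Unary.All as All using (All; []; _∷_)
import Data.List.Relation.Unary.All.Properties as All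
import Data.List.Relation.Unary.AllPairs as AllPairs
import Data.List.Relation.Unary.AllPairs.Properties as AllPairs
open import Data.List.Relation.Unary.Any using (here)
open import Data.List.Relation.Unary.Linked as Linked using (Linked; []; [-]; _∷_)
open import Data.List.Relation.Unary.Linked.Properties using (Linked⇒All)
open import Data.List.Relation.Unary.Unique.Propositional using (Unique)
import Data.List.Relation.Unary.Unique.Propositional.Properties as Unique
open import Data.Product.Base using (∃-syntax; _×_; _,_; proj₁; proj₂)
open import Data.Sum.Base using (inj₁; inj₂)
open import Data.Bool.Base using (if_then_else_)
open import Function.Base using (flip)
open import Function.Bundles using (_⇔_; mk⇔; module Equivalence)
open import Relation.Nullary using (Dec; ¬?; does; contradiction)
import Relation.Nullary.Decidable as Dec
open import Relation.Binary.PropositionalEquality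

record IsPartition (n : ℕ) (ps : List ℕ) : Set where
  constructor mkPartition
  field
    positive      : All (0 <_) ps
    nonIncreasing : Linked _≥_ ps
    sum≡          : sum ps ≡ n

-- All partitions of n whose parts are at most m; in the successor case,
-- k is the multiplicity of the part suc m.
partitions≤ : (m n : ℕ) → List (List ℕ)
partitions≤ zero    zero    = [] ∷ []
partitions≤ zero    (suc _) = []
partitions≤ (suc m) n       =
  concatMap (λ k → map (replicate k (suc m) ++_) (partitions≤ m (n ∸ k * suc m)))
            (upTo (suc (n / suc m)))

partitions : ℕ → List (List ℕ)
partitions n = partitions≤ n n

Regular : ℕ → List ℕ → Set
Regular ℓ = All (ℓ ∤_)

regular? : ∀ ℓ ps → Dec (Regular ℓ ps)
regular? ℓ = All.all? (λ q → ¬? (ℓ ∣? q))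

b : (ℓ n : ℕ) → ℕ
b ℓ n = length (filter (regular? ℓ) (partitions n))

-- The list counted by b ℓ n contains each ℓ-regular partition of n exactly
-- once: see ∈-b and unique-b below.

cons-linked : ∀ {x ps} → All (_≤ x) ps → Linked _≥_ ps → Linked _≥_ (x ∷ ps)
cons-linked []      []  = [-]
cons-linked (p ∷ _) lk  = p ∷ lk

replicate-++ : ∀ k {m qs} → All (_≤ m) qs → Linked _≥_ qs →
               All (_≤ suc m) (replicate k (suc m) ++ qs) ×
               Linked _≥_ (replicate k (suc m) ++ qs)
replicate-++ zero    bd lk = All.map m≤n⇒m≤1+n bd , lk
replicate-++ (suc k) bd lk with replicate-++ k bd lk
... | bd′ , lk′ = (≤-refl ∷ bd′) , cons-linked bd′ lk′

sum-replicate : ∀ k s qs → sum (replicate k s ++ qs) ≡ k * s + sum qs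
sum-replicate zero    s qs = refl
sum-replicate (suc k) s qs =
  trans (cong (_+_ s) (sum-replicate k s qs)) (sym (+-assoc s (k * s) (sum qs)))

split-replicate : ∀ m ps → All (_≤ suc m) ps → Linked _≥_ ps →
                  ∃[ k ] ∃[ qs ] ps ≡ replicate k (suc m) ++ qs × All (_≤ m) qs
split-replicate m []       bd       lk = 0 , [] , refl , []
split-replicate m (p ∷ ps) (b₀ ∷ bd) lk with m≤n⇒m<n∨m≡n b₀
... | inj₁ (s≤s p≤m) =
  0 , p ∷ ps , refl , All.map (λ x≤p → ≤-trans x≤p p≤m) (Linked⇒All (flip ≤-trans) ≤-refl lk)
... | inj₂ refl with split-replicate m ps bd (Linked.tail lk)
...   | k , qs , refl , bd′ = suc k , qs , refl , bd′

linked-dropʳ : ∀ k {s qs} → Linked _≥_ (replicate k s ++ qs) → Linked _≥_ qs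
linked-dropʳ zero    lk = lk
linked-dropʳ (suc k) lk = linked-dropʳ k (Linked.tail lk)

replicate-injective : ∀ k k′ {m qs qs′} → All (_≤ m) qs → All (_≤ m) qs′ →
  replicate k (suc m) ++ qs ≡ replicate k′ (suc m) ++ qs′ → k ≡ k′
replicate-injective zero    zero     _ _ _ = refl
replicate-injective zero    (suc k′) (p ∷ _) _ refl = contradiction p 1+n≰n
replicate-injective (suc k) zero     _ (p ∷ _) refl = contradiction p 1+n≰n
replicate-injective (suc k) (suc k′) x y eq =
  cong suc (replicate-injective k k′ x y (∷-injectiveʳ eq))

partitions≤-sound : ∀ m n {ps} → ps ∈ partitions≤ m n → IsPartition n ps × All (_≤ m) ps
partitions≤-sound zero    zero (here refl) = mkPartition [] [] refl , []
partitions≤-sound (suc m) n    ps∈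
  with k , k∈ , ps∈k ← find (∈-concatMap⁻ _ {xs = upTo (suc (n / suc m))} ps∈)
  with qs , qs∈ , refl ← ∈-map⁻ (replicate k (suc m) ++_) ps∈k
  with mkPartition pos lk eq , bd ← partitions≤-sound m (n ∸ k * suc m) qs∈
  with bd′ , lk′ ← replicate-++ k bd lk =
    mkPartition (All.++⁺ (All.replicate⁺ k z<s) pos) lk′
      (trans (sum-replicate k (suc m) qs)
        (trans (cong (_+_ (k * suc m)) eq) (m+[n∸m]≡n k*s≤n)))
    , bd′
  where
  k*s≤n : k * suc m ≤ n
  k*s≤n = ≤-trans (*-monoˡ-≤ (suc m) (s≤s⁻¹ (∈-upTo⁻ k∈))) (m/n*n≤m n (suc m))

partitions≤-complete : ∀ m n {ps} → IsPartition n ps → All (_≤ m) ps → ps ∈ partitions≤ m n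
partitions≤-complete zero n (mkPartition [] _ refl) [] = here refl
partitions≤-complete zero n (mkPartition (p ∷ _) _ _) (q ∷ _) = contradiction (≤-trans p q) 1+n≰n
partitions≤-complete (suc m) n {ps} (mkPartition pos lk refl) bd
  with k , qs , refl , bd′ ← split-replicate m ps bd lk =
    ∈-concatMap⁺ _ (lose (∈-upTo⁺ (s≤s k≤))
      (∈-map⁺ (replicate k (suc m) ++_)
        (partitions≤-complete m _
          (mkPartition (All.++⁻ʳ (replicate k (suc m)) pos) (linked-dropʳ k lk) sum-qs) bd′)))
  where
  sum-eq : sum (replicate k (suc m) ++ qs) ≡ k * suc m + sum qs
  sum-eq = sum-replicate k (suc m) qs
  k≤ : k ≤ sum (replicate k (suc m) ++ qs) / suc m
  k≤ = subst (_≤ sum (replicate k (suc m) ++ qs) / suc m) (m*n/n≡m k (suc m))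
    (/-monoˡ-≤ (suc m) (subst (k * suc m ≤_) (sym sum-eq) (m≤m+n _ _)))
  sum-qs : sum qs ≡ sum (replicate k (suc m) ++ qs) ∸ k * suc m
  sum-qs = sym (trans (cong (_∸ k * suc m) sum-eq) (m+n∸m≡n (k * suc m) (sum qs)))

partitions≤-unique : ∀ m n → Unique (partitions≤ m n)
partitions≤-unique zero    zero    = [] AllPairs.∷ AllPairs.[]
partitions≤-unique zero    (suc n) = AllPairs.[]
partitions≤-unique (suc m) n =
  Unique.concat⁺
    (All.map⁺ (All.tabulate λ {k} _ →
      Unique.map⁺ (++-cancelˡ (replicate k (suc m)) _ _) (partitions≤-unique m (n ∸ k * suc m))))
    (AllPairs.map⁺ (AllPairs.map disjoint (Unique.upTo⁺ (suc (n / suc m)))))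
  where
  block : ℕ → List (List ℕ)
  block k = map (replicate k (suc m) ++_) (partitions≤ m (n ∸ k * suc m))
  disjoint : ∀ {k k′} → k ≢ k′ → ∀ {ps} → ps ∈ block k × ps ∈ block k′ → _
  disjoint {k} {k′} k≢k′ (x , y)
    with qs  , qs∈  , refl ← ∈-map⁻ (replicate k (suc m) ++_) x
    with qs′ , qs∈′ , eq   ← ∈-map⁻ (replicate k′ (suc m) ++_) y =
      k≢k′ (replicate-injective k k′ (proj₂ (partitions≤-sound m _ qs∈))
        (proj₂ (partitions≤-sound m _ qs∈′)) eq)

parts≤sum : ∀ ps → All (_≤ sum ps) ps
parts≤sum []       = []
parts≤sum (p ∷ ps) = m≤m+n p _ ∷ All.map (λ q → ≤-trans q (m≤n+m _ p)) (parts≤sum ps)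

∈-partitions : ∀ n {ps} → ps ∈ partitions n ⇔ IsPartition n ps
∈-partitions n = mk⇔ (λ x → proj₁ (partitions≤-sound n n x))
  (λ { ip@(mkPartition _ _ refl) → partitions≤-complete n n ip (parts≤sum _) })

∈-b : ∀ ℓ n {ps} →
  ps ∈ filter (regular? ℓ) (partitions n) ⇔ (IsPartition n ps × Regular ℓ ps)
∈-b ℓ n = mk⇔
  (λ x → let y , r = ∈-filter⁻ (regular? ℓ) x in Equivalence.to (∈-partitions n) y , r)
  (λ (ip , r) → ∈-filter⁺ (regular? ℓ) (Equivalence.from (∈-partitions n) ip) r)

unique-b : ∀ ℓ n → Unique (filter (regular? ℓ) (partitions n))
unique-b ℓ n = Unique.filter⁺ (regular? ℓ) (partitions≤-unique n n)

QuadraticResidue : ℤ → ℕ → Set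
QuadraticResidue a p = ∃[ x ] (+ p) ℤ∣.∣ (x ℤ.* x ℤ.- a)

quadraticResidue? : ∀ a p .{{_ : NonZero p}} → Dec (QuadraticResidue a p)
quadraticResidue? a p = Dec.map′
  (λ (i , d) → + toℕ i , d)
  reduce
  (any? λ i → (+ p) ℤ∣.∣? ((+ toℕ i) ℤ.* (+ toℕ i) ℤ.- a))
  where
  identity : ∀ r q p a →
    ((r ℤ.+ q ℤ.* p) ℤ.* (r ℤ.+ q ℤ.* p) ℤ.- a) ℤ.- (r ℤ.* q ℤ.+ q ℤ.* r ℤ.+ q ℤ.* q ℤ.* p) ℤ.* p
    ≡ r ℤ.* r ℤ.- a
  identity = solve-∀
  reduce : QuadraticResidue a p → ∃[ i ] (+ p) ℤ∣.∣ ((+ toℕ {p} i) ℤ.* (+ toℕ i) ℤ.- a)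
  reduce (x , d) = fromℕ< r<p ,
    subst (λ r → (+ p) ℤ∣.∣ ((+ r) ℤ.* (+ r) ℤ.- a)) (sym (toℕ-fromℕ< r<p))
      (subst ((+ p) ℤ∣.∣_) (identity r q (+ p) a)
        (ℤ∣.∣m∣n⇒∣m-n
          (subst (λ y → (+ p) ℤ∣.∣ (y ℤ.* y ℤ.- a)) (ℤD.a≡a%ℕn+[a/ℕn]*n x p) d)
          (ℤ∣.∣n⇒∣m*n (r ℤ.* q ℤ.+ q ℤ.* r ℤ.+ q ℤ.* q ℤ.* + p) ℤ∣.∣-refl)))
    where
    r = + (x %ℕ p)
    q = x /ℕ p
    r<p : x %ℕ p < p
    r<p = ℤD.n%ℕd<d x p

-- Meant for odd p only; at p = 2 the value at odd a is 1.
legendre : ℤ → (p : ℕ) → Prime p → ℤ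
legendre a p prm =
  if does ((+ p) ℤ∣.∣? a) then 0ℤ
  else if does (quadraticResidue? a p {{prime⇒nonZero prm}}) then 1ℤ
  else -1ℤ

{-# OPTIONS --safe #-}

-- Modulo 2, ∏ (1 − q⁴ⁿ)/(1 − qⁿ) equals ∏ (1 − q²ⁿ)/(1 − q²ⁿ⁻¹), which by Gauss is the sum of
-- q^(k(k+1)/2); so b 4 N is odd only if 8N + 1 is a square.  For the N of the theorem,
-- 8N + 1 = p²ᵅ (8pn + 8j + 1), and if this is a square then 8j + 1 is a square mod p.
-- Gauss's identity is obtained from Shanks' finite form of it, where the sum telescopes; all
-- denominators are cleared, so that only multiplications by 1 + qᵃ occur.

module Submission where

open import Defs
open import Data.Nat using (ℕ; _+_; _*_; _∸_; _^_; _≤_; _/_; _%_)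
open import Data.Nat.Primality using (Prime)
open import Data.Integer using (+_; -1ℤ)
open import Relation.Binary.PropositionalEquality using (_≡_; _≢_)

open import Data.Nat.Base using (zero; suc; _<_; s≤s; NonZero; parity)
open import Data.Nat.DivMod
  using ([m+kn]%n≡m%n; m/n≡1+[m∸n]/n; m<n⇒m/n≡0; m*n/n≡m)
open import Data.Nat.Divisibility using (_∣_; _∤_; divides; n∣m⇒m%n≡0)
open import Data.Nat.Primality using (prime⇒nonZero; prime⇒irreducible; euclidsLemma)
open import Data.Nat.Properties
  using (≤-refl; ≤-trans; n≤1+n; m≤m+n; m≤n+m; m≤m*n; m≤n*m; <-≤-connex; m≤n⇒∃[o]m+o≡n;
         +-comm; +-identityʳ; *-comm; *-suc; *-identityˡ; *-identityʳ; *-monoʳ-≤; *-cancelˡ-≡; m*n≢0;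
         m+n∸m≡n; [m+n]∸[m+o]≡n∸o; ^-distribˡ-+-*)
open import Data.Nat.Tactic.RingSolver using (solve-∀)
import Data.Integer.Base as ℤ
import Data.Integer.Divisibility.Signed as ℤ∣
import Data.Integer.Properties as ℤ
open import Data.Parity.Base using (Parity; 0ℙ; 1ℙ) renaming (_+_ to _⊕_; _*_ to _⊗_)
open import Data.Parity.Properties using (p+p≡0ℙ; +-homo-+; *-homo-*; +-commutativeSemigroup)
  renaming (+-identityʳ to ⊕-identityʳ; +-cancelʳ-≡ to ⊕-cancelʳ; +-comm to ⊕-comm; +-assoc to ⊕-assoc)
open import Algebra.Properties.CommutativeSemigroup +-commutativeSemigroup using (interchange)
open import Data.Bool.Base using (if_then_else_)
open import Data.List.Base
  using (List; []; _∷_; _++_; map; filter; length; replicate; upTo; applyUpTo; concat; concatMap)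
open import Data.List.Properties
  using (map-id; map-∘; map-applyUpTo; map-concatMap; concatMap-cong; ++-identityʳ;
         length-++; filter-++; filter-accept; filter-reject)
open import Data.List.Relation.Unary.All using (_∷_)
open import Data.Product.Base using (_×_; _,_; ∃-syntax)
open import Data.Sum.Base using (_⊎_; inj₁; inj₂)
open import Function.Base using (_∘_; id)
open import Relation.Binary.Bundles using (Setoid)
open import Relation.Binary.PropositionalEquality
  using (refl; sym; trans; cong; cong₂; subst; module ≡-Reasoning)
import Relation.Binary.Reasoning.Setoid as SetoidReasoning
open import Relation.Nullary using (¬_; Dec; does; yes; no; contradiction)

-- Power series over the field with two elements

Series : Set
Series = ℕ → Parity

infix 4 _≈[_]_

-- Congruence modulo q^N. The precision is carried explicitly because finite products stand in for
-- infinite ones and match them only up to a bound.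
record _≈[_]_ (f : Series) (N : ℕ) (g : Series) : Set where
  constructor coeffs
  field coeff : ∀ k → k < N → f k ≡ g k

open _≈[_]_

≈-setoid : ℕ → Setoid _ _
≈-setoid N = record
  { Carrier = Series
  ; _≈_ = _≈[ N ]_
  ; isEquivalence = record
    { refl  = coeffs λ _ _ → refl
    ; sym   = λ e → coeffs λ k k< → sym (coeff e k k<)
    ; trans = λ e e′ → coeffs λ k k< → trans (coeff e k k<) (coeff e′ k k<)
    }
  }

module _ {N : ℕ} where
  open Setoid (≈-setoid N) public using () renaming (refl to ≈-refl; sym to ≈-sym; trans to ≈-trans)
  module ≈-Reasoning = SetoidReasoning (≈-setoid N)

≈-weaken : ∀ {M N f g} → M ≤ N → f ≈[ N ] g → f ≈[ M ] g
≈-weaken M≤N e = coeffs λ k k< → coeff e k (≤-trans k< M≤N)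

infixl 6 _⊞_

-- Opaque so that f and g can be inferred from f ⊞ g.
opaque
  _⊞_ : Series → Series → Series
  (f ⊞ g) k = f k ⊕ g k

𝟘 𝟙 : Series
𝟘 _ = 0ℙ
𝟙 zero    = 1ℙ
𝟙 (suc _) = 0ℙ

opaque
  unfolding _⊞_

  ⊞-cong : ∀ {N f f′ g g′} → f ≈[ N ] f′ → g ≈[ N ] g′ → f ⊞ g ≈[ N ] f′ ⊞ g′
  ⊞-cong e e′ = coeffs λ k k< → cong₂ _⊕_ (coeff e k k<) (coeff e′ k k<)

  ⊞-cancelʳ : ∀ h {N f g} → f ⊞ h ≈[ N ] g ⊞ h → f ≈[ N ] g
  ⊞-cancelʳ h e = coeffs λ k k< → ⊕-cancelʳ (h k) _ _ (coeff e k k<)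

  ⊞-interchange : ∀ {N} f g h i → (f ⊞ g) ⊞ (h ⊞ i) ≈[ N ] (f ⊞ h) ⊞ (g ⊞ i)
  ⊞-interchange f g h i = coeffs λ k _ → interchange (f k) (g k) (h k) (i k)

  ⊞-identityʳ : ∀ {N} f → f ⊞ 𝟘 ≈[ N ] f
  ⊞-identityʳ f = coeffs λ k _ → ⊕-identityʳ (f k)

  ⊞-self : ∀ {N} f → f ⊞ f ≈[ N ] 𝟘
  ⊞-self f = coeffs λ k _ → p+p≡0ℙ (f k)

  ⊞-comm : ∀ {N} f g → f ⊞ g ≈[ N ] g ⊞ f
  ⊞-comm f g = coeffs λ k _ → ⊕-comm (f k) (g k)

  ⊞-assoc : ∀ {N} f g h → (f ⊞ g) ⊞ h ≈[ N ] f ⊞ (g ⊞ h)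
  ⊞-assoc f g h = coeffs λ k _ → ⊕-assoc (f k) (g k) (h k)

⊞-cancel-middle : ∀ {N} f g h → (f ⊞ g) ⊞ (g ⊞ h) ≈[ N ] f ⊞ h
⊞-cancel-middle f g h = begin
  (f ⊞ g) ⊞ (g ⊞ h)  ≈⟨ ⊞-cong (⊞-comm f g) ≈-refl ⟩
  (g ⊞ f) ⊞ (g ⊞ h)  ≈⟨ ⊞-interchange g f g h ⟩
  (g ⊞ g) ⊞ (f ⊞ h)  ≈⟨ ⊞-cong (⊞-self g) ≈-refl ⟩
  𝟘 ⊞ (f ⊞ h)        ≈⟨ ⊞-comm 𝟘 (f ⊞ h) ⟩
  (f ⊞ h) ⊞ 𝟘        ≈⟨ ⊞-identityʳ (f ⊞ h) ⟩
  f ⊞ h              ∎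
  where open ≈-Reasoning

⊞-transpose : ∀ {N f g h} → f ⊞ g ≈[ N ] h → f ≈[ N ] g ⊞ h
⊞-transpose {f = f} {g} {h} e = begin
  f            ≈⟨ ⊞-identityʳ f ⟨
  f ⊞ 𝟘        ≈⟨ ⊞-cong ≈-refl (⊞-self g) ⟨
  f ⊞ (g ⊞ g)  ≈⟨ ⊞-assoc f g g ⟨
  (f ⊞ g) ⊞ g  ≈⟨ ⊞-cong e ≈-refl ⟩
  h ⊞ g        ≈⟨ ⊞-comm h g ⟩
  g ⊞ h        ∎
  where open ≈-Reasoning

shift : Series → Series
shift f zero    = 0ℙ
shift f (suc k) = f k

-- Multiplication by qᵃ and by 1 + qᵃ.
X : ℕ → Series → Series
X zero    f = f
X (suc a) f = shift (X a f)

D : ℕ → Series → Series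
D a f = f ⊞ X a f

X-X : ∀ a {b} f → X a (X b f) ≡ X (a + b) f
X-X zero    f = refl
X-X (suc a) f = cong shift (X-X a f)

X-below : ∀ a {N} f → N ≤ a → X a f ≈[ N ] 𝟘
X-below a f N≤a = coeffs λ k k< → vanish a k (≤-trans k< N≤a)
  where
  vanish : ∀ a k → k < a → X a f k ≡ 0ℙ
  vanish (suc a) zero    _         = refl
  vanish (suc a) (suc k) (s≤s k<a) = vanish a k k<a

X-+ : ∀ a f k → X a f (a + k) ≡ f k
X-+ zero    f k = refl
X-+ (suc a) f k = X-+ a f k

X-𝟙 : ∀ a k → X a 𝟙 k ≡ 1ℙ → k ≡ a
X-𝟙 zero    zero    _ = refl
X-𝟙 (suc a) (suc k) e = cong suc (X-𝟙 a k e)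

-- The shift gains one coefficient of precision, which drives the induction in `D-injective`.
shift-cong : ∀ {N f g} → f ≈[ N ] g → shift f ≈[ suc N ] shift g
shift-cong e = coeffs λ { zero _ → refl ; (suc k) (s≤s k<) → coeff e k k< }

X-cong : ∀ a {N f g} → f ≈[ N ] g → X a f ≈[ N ] X a g
X-cong zero    e = e
X-cong (suc a) e = ≈-weaken (n≤1+n _) (shift-cong (X-cong a e))

opaque
  unfolding _⊞_

  X-⊞ : ∀ a {N} f g → X a (f ⊞ g) ≈[ N ] X a f ⊞ X a g
  X-⊞ zero    f g = ≈-refl
  X-⊞ (suc a) f g = ≈-weaken (n≤1+n _)
    (≈-trans (shift-cong (X-⊞ a f g)) (coeffs λ { zero _ → refl ; (suc _) _ → refl }))

-- Additive maps commuting with multiplication by q, i.e. multiplications by a series.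
record Linear (T : Series → Series) : Set where
  field
    T-cong : ∀ {N f g} → f ≈[ N ] g → T f ≈[ N ] T g
    T-⊞    : ∀ {N} f g → T (f ⊞ g) ≈[ N ] T f ⊞ T g
    T-X    : ∀ a {N} f → T (X a f) ≈[ N ] X a (T f)

  T-D : ∀ a {N} f → T (D a f) ≈[ N ] D a (T f)
  T-D a f = ≈-trans (T-⊞ f (X a f)) (⊞-cong ≈-refl (T-X a f))

  T-𝟘 : ∀ {N f} → f ≈[ N ] 𝟘 → T f ≈[ N ] 𝟘
  T-𝟘 {f = f} f≈𝟘 = begin
    T f        ≈⟨ T-cong (≈-trans f≈𝟘 (≈-sym (⊞-self f))) ⟩
    T (f ⊞ f)  ≈⟨ T-⊞ f f ⟩
    T f ⊞ T f  ≈⟨ ⊞-self (T f) ⟩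
    𝟘          ∎
    where open ≈-Reasoning

open Linear

D-linear : ∀ a → Linear (D a)
D-linear a .T-cong e    = ⊞-cong e (X-cong a e)
D-linear a .T-⊞ f g     = ≈-trans (⊞-cong ≈-refl (X-⊞ a f g)) (⊞-interchange f g (X a f) (X a g))
D-linear a .T-X b f     = begin
  X b f ⊞ X a (X b f)  ≡⟨ cong (X b f ⊞_) X-comm ⟩
  X b f ⊞ X b (X a f)  ≈⟨ X-⊞ b f (X a f) ⟨
  X b (D a f)          ∎
  where
  open ≈-Reasoning
  X-comm : X a (X b f) ≡ X b (X a f)
  X-comm = trans (X-X a f) (trans (cong (λ c → X c f) (+-comm a b)) (sym (X-X b f)))

D-cong : ∀ a {N f g} → f ≈[ N ] g → D a f ≈[ N ] D a g
D-cong a = T-cong (D-linear a)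

D-comm : ∀ a b {N} f → D a (D b f) ≈[ N ] D b (D a f)
D-comm a b = T-D (D-linear a) b

-- Induction on the precision: agreement below N makes the shifted summands agree below `suc N`,
-- where they can be cancelled. The exponent must be positive, since 1 + q⁰ is zero modulo 2.
D-injective : ∀ a {N f g} → D (suc a) f ≈[ N ] D (suc a) g → f ≈[ N ] g
D-injective a {zero}  e = coeffs λ _ ()
D-injective a {suc N} {f} {g} e =
  ⊞-cancelʳ (X (suc a) f) (≈-trans e (⊞-cong ≈-refl (≈-sym (shift-cong (X-cong a f≈g)))))
  where
  f≈g : f ≈[ N ] g
  f≈g = D-injective a (≈-weaken (n≤1+n N) e)

-- Frobenius in characteristic 2: the two cross terms `X a f` cancel.
D-square : ∀ a {N} f → D a (D a f) ≈[ N ] D (a + a) f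
D-square a f = begin
  (f ⊞ X a f) ⊞ X a (f ⊞ X a f)        ≈⟨ ⊞-cong ≈-refl (X-⊞ a f (X a f)) ⟩
  (f ⊞ X a f) ⊞ (X a f ⊞ X a (X a f))  ≡⟨ cong (λ g → (f ⊞ X a f) ⊞ (X a f ⊞ g)) (X-X a f) ⟩
  (f ⊞ X a f) ⊞ (X a f ⊞ X (a + a) f)  ≈⟨ ⊞-cancel-middle f (X a f) _ ⟩
  f ⊞ X (a + a) f                      ∎
  where open ≈-Reasoning

-- Finite products of binomials 1 + qᵃ

∏ : (ℕ → ℕ) → ℕ → Series → Series
∏ e zero    f = f
∏ e (suc n) f = D (e n) (∏ e n f)

∏-linear : ∀ e n → Linear (∏ e n)
∏-linear e zero    .T-cong e≈  = e≈
∏-linear e zero    .T-⊞ f g    = ≈-refl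
∏-linear e zero    .T-X a f    = ≈-refl
∏-linear e (suc n) .T-cong e≈  = D-cong (e n) (T-cong (∏-linear e n) e≈)
∏-linear e (suc n) .T-⊞ f g    =
  ≈-trans (D-cong (e n) (T-⊞ (∏-linear e n) f g)) (T-⊞ (D-linear (e n)) _ _)
∏-linear e (suc n) .T-X a f    =
  ≈-trans (D-cong (e n) (T-X (∏-linear e n) a f)) (T-X (D-linear (e n)) a _)

∏-injective : ∀ e n {N f g} → ∏ (suc ∘ e) n f ≈[ N ] ∏ (suc ∘ e) n g → f ≈[ N ] g
∏-injective e zero    e≈ = e≈
∏-injective e (suc n) e≈ = ∏-injective e n (D-injective (e n) e≈)

-- Shanks' finite form of Gauss's identity

-- With indices from 0: ∏ odd n and ∏ even n multiply by (1 + q)(1 + q³)⋯(1 + q²ⁿ⁻¹) and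
-- (1 + q²)(1 + q⁴)⋯(1 + q²ⁿ).
odd even : ℕ → ℕ
odd  r = suc (2 * r)
even r = suc (suc (2 * r))

-- The sum of q^(k(k+1)/2) over k ≤ 2m.
ψ : ℕ → Series
ψ zero    = 𝟙
ψ (suc m) = (ψ m ⊞ X (suc m * odd m) 𝟙) ⊞ X (suc m * odd (suc m)) 𝟙

-- The sum over k ≤ s of (1 + q)⋯(1 + q²ᵏ⁻¹) · (1 + q²ᵏ⁺²)⋯(1 + q²ˢ) · q^(k(2n+1)).
shanks : ℕ → ℕ → Series
shanks n zero    = 𝟙
shanks n (suc s) = D (even s) (shanks n s) ⊞ ∏ odd (suc s) (X (suc s * odd n) 𝟙)

-- The polynomial identity behind the telescoping. Modulo 2, the constants and the terms q²ˢ⁺²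
-- cancel in pairs; what remains is q²ᵐ⁺¹ + q²ᵐ⁺²ˢ⁺⁴, which equals q²ᵐ⁺¹(1 + q²ˢ⁺³).
D-difference : ∀ {m s N} Y →
  D (even s) Y ⊞ (D (even m) (X (even s) Y) ⊞ D (odd m) Y) ≈[ N ] D (odd (suc s)) (X (odd m) Y)
D-difference {m} {s} Y = begin
  (Y ⊞ C) ⊞ ((C ⊞ X (even m) C) ⊞ (Y ⊞ Z))
    ≡⟨ cong (λ W → (Y ⊞ C) ⊞ ((C ⊞ W) ⊞ (Y ⊞ Z))) same ⟩
  (Y ⊞ C) ⊞ ((C ⊞ R) ⊞ (Y ⊞ Z))  ≈⟨ ⊞-assoc (Y ⊞ C) (C ⊞ R) (Y ⊞ Z) ⟨
  ((Y ⊞ C) ⊞ (C ⊞ R)) ⊞ (Y ⊞ Z)  ≈⟨ ⊞-cong (⊞-cancel-middle Y C R) ≈-refl ⟩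
  (Y ⊞ R) ⊞ (Y ⊞ Z)              ≈⟨ ⊞-cong (⊞-comm Y R) ≈-refl ⟩
  (R ⊞ Y) ⊞ (Y ⊞ Z)              ≈⟨ ⊞-cancel-middle R Y Z ⟩
  R ⊞ Z                          ≈⟨ ⊞-comm R Z ⟩
  Z ⊞ R                          ∎
  where
  open ≈-Reasoning
  C R Z : Series
  C = X (even s) Y
  Z = X (odd m) Y
  R = X (odd (suc s)) Z
  exponents : ∀ m s → suc (suc (2 * m)) + suc (suc (2 * s)) ≡ suc (2 * suc s) + suc (2 * m)
  exponents = solve-∀
  same : X (even m) C ≡ R
  same = trans (X-X (even m) Y) (trans (cong (λ c → X c Y) (exponents m s)) (sym (X-X (odd (suc s)) Y)))

-- Sums for consecutive values of the first index, suitably weighted, differ by a single term. In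
-- the induction on s the hypothesis is multiplied by 1 + q²ˢ⁺²; it and the two new summands then
-- share the factor `P`, and `D-difference` adds up the cofactors.
shanks-telescopes : ∀ m s {N} →
  D (even m) (shanks (suc m) s) ⊞ D (odd m) (shanks m s) ≈[ N ] ∏ odd (suc s) (X (suc s * odd m) 𝟙)
shanks-telescopes m zero = begin
  D (even m) 𝟙 ⊞ D (odd m) 𝟙               ≈⟨ ⊞-cong (⊞-comm 𝟙 _) ≈-refl ⟩
  (X (even m) 𝟙 ⊞ 𝟙) ⊞ (𝟙 ⊞ X (odd m) 𝟙)   ≈⟨ ⊞-cancel-middle _ 𝟙 _ ⟩
  X (even m) 𝟙 ⊞ X (odd m) 𝟙               ≈⟨ ⊞-comm _ _ ⟩
  X (odd m) 𝟙 ⊞ X (even m) 𝟙               ≡⟨ cong (λ c → X c 𝟙 ⊞ X (suc c) 𝟙) (sym (+-identityʳ (odd m))) ⟩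
  X (1 * odd m) 𝟙 ⊞ X 1 (X (1 * odd m) 𝟙)  ∎
  where open ≈-Reasoning
shanks-telescopes m (suc s) = begin
  D e (D c A ⊞ P (X (suc s * odd (suc m)) 𝟙)) ⊞ D o (D c B ⊞ P Y)
    ≡⟨ cong (λ Z → D e (D c A ⊞ P Z) ⊞ D o (D c B ⊞ P Y)) shifted ⟩
  D e (D c A ⊞ P (X c Y)) ⊞ D o (D c B ⊞ P Y)
    ≈⟨ ⊞-cong (regroup e A (X c Y)) (regroup o B Y) ⟩
  (D c (D e A) ⊞ P (D e (X c Y))) ⊞ (D c (D o B) ⊞ P (D o Y))
    ≈⟨ ⊞-interchange _ _ _ _ ⟩
  (D c (D e A) ⊞ D c (D o B)) ⊞ (P (D e (X c Y)) ⊞ P (D o Y))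
    ≈⟨ ⊞-cong (T-⊞ (D-linear c) _ _) (T-⊞ P-linear _ _) ⟨
  D c (D e A ⊞ D o B) ⊞ P (D e (X c Y) ⊞ D o Y)
    ≈⟨ ⊞-cong (≈-trans (D-cong c (shanks-telescopes m s)) (≈-sym (T-D P-linear c Y))) ≈-refl ⟩
  P (D c Y) ⊞ P (D e (X c Y) ⊞ D o Y)
    ≈⟨ T-⊞ P-linear _ _ ⟨
  P (D c Y ⊞ (D e (X c Y) ⊞ D o Y))
    ≈⟨ T-cong P-linear (D-difference {m} {s} Y) ⟩
  P (D (odd (suc s)) (X o Y))
    ≈⟨ T-D P-linear (odd (suc s)) (X o Y) ⟩
  D (odd (suc s)) (P (X o Y))
    ≡⟨ cong (D (odd (suc s)) ∘ P) (X-X o 𝟙) ⟩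
  D (odd (suc s)) (P (X (suc (suc s) * odd m) 𝟙)) ∎
  where
  open ≈-Reasoning
  e o c : ℕ
  e = even m
  o = odd m
  c = even s
  A B Y : Series
  A = shanks (suc m) s
  B = shanks m s
  Y = X (suc s * odd m) 𝟙
  P : Series → Series
  P = ∏ odd (suc s)
  P-linear : Linear P
  P-linear = ∏-linear odd (suc s)
  exponents : ∀ m s → suc s * suc (2 * suc m) ≡ suc (suc (2 * s)) + suc s * suc (2 * m)
  exponents = solve-∀
  -- Raising m by one multiplies the monomial by q²ˢ⁺², the power that also occurs in `D c`.
  shifted : X (suc s * odd (suc m)) 𝟙 ≡ X c Y
  shifted = trans (cong (λ a → X a 𝟙) (exponents m s)) (sym (X-X c 𝟙))
  regroup : ∀ d {N} f g → D d (D c f ⊞ P g) ≈[ N ] D c (D d f) ⊞ P (D d g)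
  regroup d f g = ≈-trans (T-⊞ (D-linear d) _ _) (⊞-cong (D-comm d c f) (≈-sym (T-D P-linear d g)))

-- A diagonal step raises both indices, and each contributes one monomial of `ψ`: `U`, with
-- triangular exponent of index 2m + 1, comes from telescoping in the first index, and `V`, of index
-- 2m + 2, is the new last summand.
shanks-diagonal : ∀ m {N} → shanks m m ≈[ N ] ∏ odd m (ψ m)
shanks-diagonal zero    = ≈-refl
shanks-diagonal (suc m) = begin
  D (even m) (shanks (suc m) m) ⊞ P V      ≈⟨ ⊞-cong (⊞-transpose (shanks-telescopes m m)) ≈-refl ⟩
  (D (odd m) (shanks m m) ⊞ P U) ⊞ P V     ≈⟨ ⊞-cong (⊞-cong (D-cong (odd m) (shanks-diagonal m)) ≈-refl) ≈-refl ⟩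
  (P (ψ m) ⊞ P U) ⊞ P V                    ≈⟨ ⊞-cong (T-⊞ P-linear _ _) ≈-refl ⟨
  P (ψ m ⊞ U) ⊞ P V                        ≈⟨ T-⊞ P-linear _ _ ⟨
  P (ψ (suc m))                            ∎
  where
  open ≈-Reasoning
  U V : Series
  U = X (suc m * odd m) 𝟙
  V = X (suc m * odd (suc m)) 𝟙
  P : Series → Series
  P = ∏ odd (suc m)
  P-linear : Linear P
  P-linear = ∏-linear odd (suc m)

-- Below q²ⁿ⁺¹ only the summand k = 0 survives, as every other one carries the factor q^(k(2n+1)).
shanks-head : ∀ n s → shanks n s ≈[ odd n ] ∏ even s 𝟙
shanks-head n zero    = ≈-refl
shanks-head n (suc s) = begin
  D (even s) (shanks n s) ⊞ ∏ odd (suc s) (X (suc s * odd n) 𝟙)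
    ≈⟨ ⊞-cong (D-cong (even s) (shanks-head n s))
              (T-𝟘 (∏-linear odd (suc s)) (X-below (suc s * odd n) 𝟙 (m≤m+n (odd n) _))) ⟩
  ∏ even (suc s) 𝟙 ⊞ 𝟘
    ≈⟨ ⊞-identityʳ _ ⟩
  ∏ even (suc s) 𝟙 ∎
  where open ≈-Reasoning

gauss : ∀ n → ∏ odd n (ψ n) ≈[ odd n ] ∏ even n 𝟙
gauss n = ≈-trans (≈-sym (shanks-diagonal n)) (shanks-head n n)

-- Partitions without parts divisible by 4

partitions≤-below : ∀ m n → n < suc m → partitions≤ (suc m) n ≡ partitions≤ m n
partitions≤-below m n n< = begin
  concatMap block (upTo (suc (n / suc m)))  ≡⟨ cong (concatMap block ∘ upTo ∘ suc) (m<n⇒m/n≡0 n<) ⟩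
  map id (partitions≤ m n) ++ []   ≡⟨ ++-identityʳ _ ⟩
  map id (partitions≤ m n)         ≡⟨ map-id _ ⟩
  partitions≤ m n                           ∎
  where
  open ≡-Reasoning
  block : ℕ → List (List ℕ)
  block k = map (replicate k (suc m) ++_) (partitions≤ m (n ∸ k * suc m))

-- Multiplicity 0 is split off: `block 0` avoids the part `suc m`, and `block (suc k)` is `block′ k`
-- with one more copy of that part in front.
partitions≤-+ : ∀ m n → partitions≤ (suc m) (suc m + n) ≡
  partitions≤ m (suc m + n) ++ map (suc m ∷_) (partitions≤ (suc m) n)
partitions≤-+ m n = begin
  concatMap block (upTo (suc ((suc m + n) / suc m)))
    ≡⟨ cong (concatMap block ∘ upTo ∘ suc) quotient ⟩
  block 0 ++ concatMap block (applyUpTo suc (suc q))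
    ≡⟨ cong₂ _++_ (map-id (partitions≤ m (suc m + n))) (cong concat reindex) ⟩
  partitions≤ m (suc m + n) ++ concatMap (block ∘ suc) (upTo (suc q))
    ≡⟨ cong (partitions≤ m (suc m + n) ++_) (concatMap-cong block-suc (upTo (suc q))) ⟩
  partitions≤ m (suc m + n) ++ concatMap (map (suc m ∷_) ∘ block′) (upTo (suc q))
    ≡⟨ cong (partitions≤ m (suc m + n) ++_) (map-concatMap (suc m ∷_) block′ (upTo (suc q))) ⟨
  partitions≤ m (suc m + n) ++ map (suc m ∷_) (partitions≤ (suc m) n) ∎
  where
  open ≡-Reasoning
  q : ℕ
  q = n / suc m
  block block′ : ℕ → List (List ℕ)
  block  k = map (replicate k (suc m) ++_) (partitions≤ m (suc m + n ∸ k * suc m))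
  block′ k = map (replicate k (suc m) ++_) (partitions≤ m (n ∸ k * suc m))
  quotient : (suc m + n) / suc m ≡ suc q
  quotient = trans (m/n≡1+[m∸n]/n (m≤m+n (suc m) n))
                   (cong (λ r → suc (r / suc m)) (m+n∸m≡n (suc m) n))
  reindex : map block (applyUpTo suc (suc q)) ≡ map (block ∘ suc) (upTo (suc q))
  reindex = trans (map-applyUpTo suc block (suc q)) (sym (map-applyUpTo id (block ∘ suc) (suc q)))
  block-suc : ∀ k → block (suc k) ≡ map (suc m ∷_) (block′ k)
  block-suc k = trans
    (cong (λ r → map (replicate (suc k) (suc m) ++_) (partitions≤ m r))
          ([m+n]∸[m+o]≡n∸o (suc m) n (k * suc m)))
    (map-∘ (partitions≤ m (n ∸ k * suc m)))

-- Generating functions of regular partitions modulo 2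

count : ℕ → List (List ℕ) → ℕ
count ℓ pss = length (filter (regular? ℓ) pss)

count-++ : ∀ ℓ pss qss → count ℓ (pss ++ qss) ≡ count ℓ pss + count ℓ qss
count-++ ℓ pss qss =
  trans (cong length (filter-++ (regular? ℓ) pss qss)) (length-++ (filter (regular? ℓ) pss))

count-accept : ∀ {ℓ} ps pss → Regular ℓ ps → count ℓ (ps ∷ pss) ≡ suc (count ℓ pss)
count-accept {ℓ} ps pss r = cong length (filter-accept (regular? ℓ) r)

count-reject : ∀ {ℓ} ps pss → ¬ Regular ℓ ps → count ℓ (ps ∷ pss) ≡ count ℓ pss
count-reject {ℓ} ps pss ¬r = cong length (filter-reject (regular? ℓ) ¬r)

count-map-∣ : ∀ {ℓ s} pss → ℓ ∣ s → count ℓ (map (s ∷_) pss) ≡ 0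
count-map-∣ []         ℓ∣s = refl
count-map-∣ (ps ∷ pss) ℓ∣s =
  trans (count-reject (_ ∷ ps) (map _ pss) λ { (ℓ∤s ∷ _) → ℓ∤s ℓ∣s }) (count-map-∣ pss ℓ∣s)

count-map-∤ : ∀ {ℓ s} pss → ℓ ∤ s → count ℓ (map (s ∷_) pss) ≡ count ℓ pss
count-map-∤         []         ℓ∤s = refl
count-map-∤ {ℓ} {s} (ps ∷ pss) ℓ∤s = by-cases (regular? ℓ ps)
  where
  by-cases : Dec (Regular ℓ ps) → count ℓ (map (s ∷_) (ps ∷ pss)) ≡ count ℓ (ps ∷ pss)
  by-cases (yes r) = trans (count-accept (s ∷ ps) (map (s ∷_) pss) (ℓ∤s ∷ r))
    (trans (cong suc (count-map-∤ pss ℓ∤s)) (sym (count-accept ps pss r)))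
  by-cases (no ¬r) = trans (count-reject (s ∷ ps) (map (s ∷_) pss) λ { (_ ∷ r) → ¬r r })
    (trans (count-map-∤ pss ℓ∤s) (sym (count-reject ps pss ¬r)))

-- Modulo 2 this is the product of 1/(1 + qⁱ) over 1 ≤ i ≤ m with ℓ ∤ i; the lemmas below establish
-- this one factor at a time.
regularSeries : ℕ → ℕ → Series
regularSeries ℓ m n = parity (count ℓ (partitions≤ m n))

regularSeries-below : ∀ ℓ {m n} → n < suc m → regularSeries ℓ (suc m) n ≡ regularSeries ℓ m n
regularSeries-below ℓ {m} {n} n< = cong (parity ∘ count ℓ) (partitions≤-below m n n<)

regularSeries-+ : ∀ ℓ m n → regularSeries ℓ (suc m) (suc m + n) ≡
  regularSeries ℓ m (suc m + n) ⊕ parity (count ℓ (map (suc m ∷_) (partitions≤ (suc m) n)))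
regularSeries-+ ℓ m n = begin
  parity (count ℓ (partitions≤ (suc m) (suc m + n)))  ≡⟨ cong (parity ∘ count ℓ) (partitions≤-+ m n) ⟩
  parity (count ℓ (pss ++ qss))                       ≡⟨ cong parity (count-++ ℓ pss qss) ⟩
  parity (count ℓ pss + count ℓ qss)                  ≡⟨ +-homo-+ (count ℓ pss) (count ℓ qss) ⟩
  parity (count ℓ pss) ⊕ parity (count ℓ qss)         ∎
  where
  open ≡-Reasoning
  pss qss : List (List ℕ)
  pss = partitions≤ m (suc m + n)
  qss = map (suc m ∷_) (partitions≤ (suc m) n)

regularSeries-∣ : ∀ ℓ m {N} → ℓ ∣ suc m → regularSeries ℓ (suc m) ≈[ N ] regularSeries ℓ m
regularSeries-∣ ℓ m ℓ∣ = coeffs λ n _ → same n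
  where
  same : ∀ n → regularSeries ℓ (suc m) n ≡ regularSeries ℓ m n
  same n with <-≤-connex n (suc m)
  ... | inj₁ n<  = regularSeries-below ℓ n<
  ... | inj₂ m<n with k , refl ← m≤n⇒∃[o]m+o≡n m<n =
    trans (regularSeries-+ ℓ m k)
      (trans (cong (λ c → regularSeries ℓ m (suc m + k) ⊕ parity c) (count-map-∣ (partitions≤ (suc m) k) ℓ∣))
             (⊕-identityʳ _))

-- The geometric series in recursive form: removing one copy of the part `suc m` gives F′ = F +
-- q^(m+1) F′, and in characteristic 2 the last term changes sides by being added.
regularSeries-∤ : ∀ ℓ m {N} → ℓ ∤ suc m → D (suc m) (regularSeries ℓ (suc m)) ≈[ N ] regularSeries ℓ m
regularSeries-∤ ℓ m {N} ℓ∤ = begin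
  F′ ⊞ X (suc m) F′                     ≈⟨ ⊞-cong (split N) ≈-refl ⟩
  (F ⊞ X (suc m) F′) ⊞ X (suc m) F′     ≈⟨ ⊞-assoc F _ _ ⟩
  F ⊞ (X (suc m) F′ ⊞ X (suc m) F′)     ≈⟨ ⊞-cong ≈-refl (⊞-self _) ⟩
  F ⊞ 𝟘                                 ≈⟨ ⊞-identityʳ F ⟩
  F                                     ∎
  where
  open ≈-Reasoning
  F F′ : Series
  F  = regularSeries ℓ m
  F′ = regularSeries ℓ (suc m)
  opaque
    unfolding _⊞_
    splitAt : ∀ n → F′ n ≡ (F ⊞ X (suc m) F′) n
    splitAt n with <-≤-connex n (suc m)
    ... | inj₁ n<  = trans (regularSeries-below ℓ n<)
      (sym (trans (cong (F n ⊕_) (coeff (X-below (suc m) F′ n<) n ≤-refl)) (⊕-identityʳ _)))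
    ... | inj₂ m<n with k , refl ← m≤n⇒∃[o]m+o≡n m<n = trans (regularSeries-+ ℓ m k)
      (cong (F (suc m + k) ⊕_)
        (trans (cong parity (count-map-∤ (partitions≤ (suc m) k) ℓ∤)) (sym (X-+ (suc m) F′ k))))
  split : ∀ N → F′ ≈[ N ] F ⊞ X (suc m) F′
  split N = coeffs λ n _ → splitAt n

-- Parts larger than n cannot occur in a partition of n.
regularSeries-stable : ∀ ℓ k n → regularSeries ℓ (k + n) n ≡ regularSeries ℓ n n
regularSeries-stable ℓ zero    n = refl
regularSeries-stable ℓ (suc k) n =
  trans (regularSeries-below ℓ (s≤s (m≤n+m n k))) (regularSeries-stable ℓ k n)

-- The product formula for parts not divisible by 4

quad : ℕ → ℕ
quad r = 4 * suc r

D-cast : ∀ {a a′ N} f → a ≡ a′ → D a f ≈[ N ] D a′ f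
D-cast f refl = ≈-refl

-- A block of four consecutive parts adds two odd and two even factors; this brings two new factors
-- innermost, where they meet the series.
∏-suc-suc : ∀ e n {N} f → ∏ e (suc (suc n)) f ≈[ N ] ∏ e n (D (e n) (D (e (suc n)) f))
∏-suc-suc e n f = begin
  D (e (suc n)) (D (e n) (∏ e n f))  ≈⟨ D-comm (e (suc n)) (e n) _ ⟩
  D (e n) (D (e (suc n)) (∏ e n f))  ≈⟨ D-cong (e n) (T-D (∏-linear e n) (e (suc n)) f) ⟨
  D (e n) (∏ e n (D (e (suc n)) f))  ≈⟨ T-D (∏-linear e n) (e n) _ ⟨
  ∏ e n (D (e n) (D (e (suc n)) f))  ∎
  where open ≈-Reasoning

-- Both sides of ∏ (1 − qⁱ)⁻¹ over 4 ∤ i, multiplied by all 1 + qⁱ with i ≤ 4M.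
regularSeries₄-product : ∀ M {N} →
  ∏ odd (M * 2) (∏ even (M * 2) (regularSeries 4 (M * 4))) ≈[ N ] ∏ quad M 𝟙
regularSeries₄-product zero    = coeffs λ { zero _ → refl ; (suc _) _ → refl }
regularSeries₄-product (suc M) = begin
  O′ (E′ (F 4))
    ≈⟨ T-cong (∏-linear odd (suc M * 2)) (∏-suc-suc even (M * 2) (F 4)) ⟩
  O′ (E (D e₂ (D e₄ (F 4))))
    ≈⟨ ∏-suc-suc odd (M * 2) _ ⟩
  O (D o₁ (D o₃ (E (D e₂ (D e₄ (F 4))))))
    ≈⟨ O-cong (D-cong o₁ (T-D E-linear o₃ _)) ⟨
  O (D o₁ (E (D o₃ (D e₂ (D e₄ (F 4))))))
    ≈⟨ O-cong (T-D E-linear o₁ _) ⟨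
  O (E (D o₁ (D o₃ (D e₂ (D e₄ (F 4))))))
    ≈⟨ O-cong (T-cong E-linear last-four) ⟩
  O (E (D (quad M) (F 0)))
    ≈⟨ O-cong (T-D E-linear (quad M) (F 0)) ⟩
  O (D (quad M) (E (F 0)))
    ≈⟨ T-D (∏-linear odd (M * 2)) (quad M) _ ⟩
  D (quad M) (O (E (F 0)))
    ≈⟨ D-cong (quad M) (regularSeries₄-product M) ⟩
  D (quad M) (∏ quad M 𝟙) ∎
  where
  open ≈-Reasoning
  F : ℕ → Series
  F r = regularSeries 4 (r + M * 4)
  O O′ E E′ : Series → Series
  O  = ∏ odd (M * 2)
  O′ = ∏ odd (suc M * 2)
  E  = ∏ even (M * 2)
  E′ = ∏ even (suc M * 2)
  o₁ e₂ o₃ e₄ : ℕ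
  o₁ = odd (M * 2)
  e₂ = even (M * 2)
  o₃ = odd (suc (M * 2))
  e₄ = even (suc (M * 2))
  E-linear : Linear E
  E-linear = ∏-linear even (M * 2)
  O-cong : ∀ {N f g} → f ≈[ N ] g → O f ≈[ N ] O g
  O-cong = T-cong (∏-linear odd (M * 2))
  o₁≡ : ∀ M → suc (2 * (M * 2)) ≡ 1 + M * 4
  o₁≡ = solve-∀
  e₂≡ : ∀ M → suc (suc (2 * (M * 2))) ≡ 2 + M * 4
  e₂≡ = solve-∀
  o₃≡ : ∀ M → suc (2 * suc (M * 2)) ≡ 3 + M * 4
  o₃≡ = solve-∀
  e₄≡ : ∀ M → suc (suc (2 * suc (M * 2))) ≡ 4 * suc M
  e₄≡ = solve-∀
  4∤ : ∀ r → r % 4 ≢ 0 → 4 ∤ r + M * 4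
  4∤ r r≢0 4∣ = r≢0 (trans (sym ([m+kn]%n≡m%n r M 4)) (n∣m⇒m%n≡0 _ 4 4∣))
  drop : ∀ r {a N} → a ≡ suc r + M * 4 → suc r % 4 ≢ 0 → D a (F (suc r)) ≈[ N ] F r
  drop r refl r≢0 = regularSeries-∤ 4 (r + M * 4) (4∤ (suc r) r≢0)
  -- The part 4M + 4 leaves the series unchanged, so its factor remains as `quad M`. Each of the
  -- other three factors cancels the part of the same size, the largest part first.
  last-four : ∀ {N} → D o₁ (D o₃ (D e₂ (D e₄ (F 4)))) ≈[ N ] D (quad M) (F 0)
  last-four = begin
    D o₁ (D o₃ (D e₂ (D e₄ (F 4))))
      ≈⟨ D-cong o₁ (D-cong o₃ (D-cong e₂ (D-cong e₄ (regularSeries-∣ 4 (3 + M * 4) (divides (suc M) refl))))) ⟩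
    D o₁ (D o₃ (D e₂ (D e₄ (F 3))))
      ≈⟨ D-cong o₁ (≈-trans (D-cong o₃ (D-comm e₂ e₄ _)) (D-comm o₃ e₄ _)) ⟩
    D o₁ (D e₄ (D o₃ (D e₂ (F 3))))
      ≈⟨ D-comm o₁ e₄ _ ⟩
    D e₄ (D o₁ (D o₃ (D e₂ (F 3))))
      ≈⟨ D-cong e₄ (D-cong o₁ (D-comm o₃ e₂ _)) ⟩
    D e₄ (D o₁ (D e₂ (D o₃ (F 3))))
      ≈⟨ D-cong e₄ (D-cong o₁ (D-cong e₂ (drop 2 (o₃≡ M) λ ()))) ⟩
    D e₄ (D o₁ (D e₂ (F 2)))
      ≈⟨ D-cong e₄ (D-cong o₁ (drop 1 (e₂≡ M) λ ())) ⟩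
    D e₄ (D o₁ (F 1))
      ≈⟨ D-cong e₄ (drop 0 (o₁≡ M) λ ()) ⟩
    D e₄ (F 0)
      ≈⟨ D-cast (F 0) (e₄≡ M) ⟩
    D (quad M) (F 0) ∎

-- Frobenius applied factor by factor. It exhibits the numerator with exponents 4i as a square, one
-- factor of which can then be cancelled.
∏-even-square : ∀ n {N} → ∏ even n (∏ even n 𝟙) ≈[ N ] ∏ quad n 𝟙
∏-even-square zero    = ≈-refl
∏-even-square (suc n) = begin
  D (even n) (∏ even n (D (even n) (∏ even n 𝟙)))  ≈⟨ D-cong (even n) (T-D (∏-linear even n) (even n) _) ⟩
  D (even n) (D (even n) (∏ even n (∏ even n 𝟙)))  ≈⟨ D-square (even n) _ ⟩
  D (even n + even n) (∏ even n (∏ even n 𝟙))      ≈⟨ D-cast _ (double n) ⟩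
  D (quad n) (∏ even n (∏ even n 𝟙))               ≈⟨ D-cong (quad n) (∏-even-square n) ⟩
  ∏ quad (suc n) 𝟙                                 ∎
  where
  open ≈-Reasoning
  double : ∀ n → suc (suc (2 * n)) + suc (suc (2 * n)) ≡ 4 * suc n
  double = solve-∀

∏-quad-truncate : ∀ k M → ∏ quad (k + M) 𝟙 ≈[ quad M ] ∏ quad M 𝟙
∏-quad-truncate zero    M = ≈-refl
∏-quad-truncate (suc k) M = begin
  g ⊞ X (quad (k + M)) g  ≈⟨ ⊞-cong ≈-refl (X-below _ g (*-monoʳ-≤ 4 (s≤s (m≤n+m M k)))) ⟩
  g ⊞ 𝟘                   ≈⟨ ⊞-identityʳ g ⟩
  g                       ≈⟨ ∏-quad-truncate k M ⟩
  ∏ quad M 𝟙              ∎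
  where
  open ≈-Reasoning
  g : Series
  g = ∏ quad (k + M) 𝟙

-- Cancelling the even product once from the product formula leaves that the odd product times the
-- series is the even product. By `gauss` the same holds for `ψ`, and the odd product cancels.
regularSeries₄≈ψ : ∀ M → regularSeries 4 (M * 4) ≈[ odd (M * 2) ] ψ (M * 2)
regularSeries₄≈ψ M = ∏-injective (2 *_) n (≈-trans OF≈E (≈-sym (gauss n)))
  where
  open ≈-Reasoning
  n : ℕ
  n = M * 2
  F : Series
  F = regularSeries 4 (M * 4)
  truncation : odd n ≤ quad M
  truncation = subst (odd n ≤_) (sym (4+4M M)) (m≤n+m (odd n) 3)
    where
    4+4M : ∀ M → 4 * suc M ≡ 3 + suc (2 * (M * 2))
    4+4M = solve-∀
  swap : ∀ m {N} f → ∏ even m (∏ odd n f) ≈[ N ] ∏ odd n (∏ even m f)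
  swap zero    f = ≈-refl
  swap (suc m) f = ≈-trans (D-cong (even m) (swap m f)) (≈-sym (T-D (∏-linear odd n) (even m) _))
  OF≈E : ∏ odd n F ≈[ odd n ] ∏ even n 𝟙
  OF≈E = ∏-injective (suc ∘ (2 *_)) n (begin
    ∏ even n (∏ odd n F)   ≈⟨ swap n F ⟩
    ∏ odd n (∏ even n F)   ≈⟨ regularSeries₄-product M ⟩
    -- The square has 2M factors while the product formula supplies M; the missing ones start at
    -- exponent 4M + 4, beyond the precision 4M + 1.
    ∏ quad M 𝟙             ≈⟨ ≈-weaken truncation (∏-quad-truncate M M) ⟨
    ∏ quad (M + M) 𝟙       ≡⟨ cong (λ k → ∏ quad k 𝟙) (doubled M) ⟩
    ∏ quad n 𝟙             ≈⟨ ∏-even-square n ⟨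
    ∏ even n (∏ even n 𝟙)  ∎)
    where
    doubled : ∀ M → M + M ≡ M * 2
    doubled = solve-∀

-- Triangular numbers and squares

⊕-odd : ∀ p q → p ⊕ q ≡ 1ℙ → p ≡ 1ℙ ⊎ q ≡ 1ℙ
⊕-odd 0ℙ q  q≡1 = inj₂ q≡1
⊕-odd 1ℙ q  _   = inj₁ refl

opaque
  unfolding _⊞_

  -- A coefficient 1 must come from one of the monomials. The exponents are triangular, and 8 ·
  -- r(r+1)/2 + 1 = (2r + 1)²; the indices r = 2m + 1 and r = 2m + 2 give the roots 4m + 3 and 4m +
  -- 5.
  ψ-support : ∀ n {k} → ψ n k ≡ 1ℙ → ∃[ y ] y * y ≡ 8 * k + 1
  ψ-support zero    {k} e with refl ← X-𝟙 0 k e = 1 , refl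
  ψ-support (suc m) {k} e with ⊕-odd ((ψ m ⊞ X (suc m * odd m) 𝟙) k) _ e
  ... | inj₂ v with refl ← X-𝟙 (suc m * odd (suc m)) k v = 5 + 4 * m , square m
    where
    square : ∀ m → (5 + 4 * m) * (5 + 4 * m) ≡ 8 * (suc m * suc (2 * suc m)) + 1
    square = solve-∀
  ... | inj₁ w with ⊕-odd (ψ m k) _ w
  ...   | inj₁ u = ψ-support m u
  ...   | inj₂ u with refl ← X-𝟙 (suc m * odd m) k u = 3 + 4 * m , square m
    where
    square : ∀ m → (3 + 4 * m) * (3 + 4 * m) ≡ 8 * (suc m * suc (2 * m)) + 1
    square = solve-∀

parity-b₄ : ∀ n → parity (b 4 n) ≡ ψ (n * 2) n
parity-b₄ n = begin
  -- Raising the bound on the parts from n to 4n costs nothing and reaches the form M * 4 with M =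
  -- n, whose precision 4n + 1 covers the coefficient n.
  regularSeries 4 n n            ≡⟨ regularSeries-stable 4 (3 * n) n ⟨
  regularSeries 4 (3 * n + n) n  ≡⟨ cong (λ m → regularSeries 4 m n) (quadruple n) ⟩
  regularSeries 4 (n * 4) n      ≡⟨ coeff (regularSeries₄≈ψ n) n (s≤s n≤4n) ⟩
  ψ (n * 2) n                    ∎
  where
  open ≡-Reasoning
  quadruple : ∀ n → 3 * n + n ≡ n * 4
  quadruple = solve-∀
  n≤4n : n ≤ 2 * (n * 2)
  n≤4n = ≤-trans (m≤m*n n 2) (m≤n*m (n * 2) 2)

parity-split : ∀ n → (parity n ≡ 0ℙ × ∃[ k ] n ≡ 2 * k) ⊎ (parity n ≡ 1ℙ × ∃[ k ] n ≡ 1 + 2 * k)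
parity-split zero          = inj₁ (refl , 0 , refl)
parity-split (suc zero)    = inj₂ (refl , 0 , refl)
parity-split (suc (suc n)) with parity-split n
... | inj₁ (e , k , refl) = inj₁ (e , suc k , sym (*-suc 2 k))
... | inj₂ (e , k , refl) = inj₂ (e , suc k , cong suc (sym (*-suc 2 k)))

b₄-even : ∀ n → (∀ y → y * y ≢ 8 * n + 1) → b 4 n % 2 ≡ 0
b₄-even n nonSquare with parity-split (b 4 n)
... | inj₁ (_ , k , b≡2k) = n∣m⇒m%n≡0 (b 4 n) 2 (divides k (trans b≡2k (*-comm 2 k)))
... | inj₂ (odd-b , _)
  with y , y²≡ ← ψ-support (n * 2) (trans (sym (parity-b₄ n)) odd-b) = contradiction y²≡ (nonSquare y)

-- Prime powers, squares and quadratic residues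

odd-prime-parity : ∀ {p} → Prime p → p ≢ 2 → parity p ≡ 1ℙ
odd-prime-parity {p} prm p≢2 with parity-split p
... | inj₂ (e , _) = e
... | inj₁ (_ , k , p≡2k) with prime⇒irreducible prm (divides k (trans p≡2k (*-comm 2 k)))
...   | inj₂ 2≡p = contradiction (sym 2≡p) p≢2

parity-^ : ∀ {m} → parity m ≡ 1ℙ → ∀ k → parity (m ^ k) ≡ 1ℙ
parity-^ {m} odd-m zero    = refl
parity-^ {m} odd-m (suc k) = trans (*-homo-* m (m ^ k)) (cong₂ _⊗_ odd-m (parity-^ odd-m k))

-- Consecutive odd squares differ by a multiple of 8. This makes the division by 8 in the argument
-- of `b 4` exact.
odd-square : ∀ k → ∃[ t ] (1 + 2 * k) * (1 + 2 * k) ≡ 1 + t * 8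
odd-square zero    = 0 , refl
odd-square (suc k) with t , e ← odd-square k =
  suc k + t , trans (step k) (trans (cong (λ S → suc k * 8 + S) e) (collect k t))
  where
  step : ∀ k → (1 + 2 * suc k) * (1 + 2 * suc k) ≡ suc k * 8 + (1 + 2 * k) * (1 + 2 * k)
  step = solve-∀
  collect : ∀ k t → suc k * 8 + (1 + t * 8) ≡ 1 + (suc k + t) * 8
  collect = solve-∀

-- Descent on α: p divides y² and hence y, so p² cancels from both sides.
square-cofactor : ∀ {p} → Prime p → ∀ α {u} y → y * y ≡ p ^ α * p ^ α * u → ∃[ x ] x * x ≡ u
square-cofactor prm zero    y e = y , trans e (*-identityˡ _)
square-cofactor {p} prm (suc α) {u} y e = descend p∣y
  where
  instance
    p*p≢0 : NonZero (p * p)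
    p*p≢0 = let instance _ = prime⇒nonZero prm in m*n≢0 p p
  factor : ∀ p r u → (p * r) * (p * r) * u ≡ (r * (p * r) * u) * p
  factor = solve-∀
  p∣y : p ∣ y
  p∣y with euclidsLemma y y prm (divides (p ^ α * (p * p ^ α) * u) (trans e (factor p (p ^ α) u)))
  ... | inj₁ d = d
  ... | inj₂ d = d
  descend : p ∣ y → ∃[ x ] x * x ≡ u
  descend (divides q refl) = square-cofactor prm α q
    (*-cancelˡ-≡ (q * q) (p ^ α * p ^ α * u) (p * p) (trans (left p q) (trans e (right p (p ^ α) u))))
    where
    left : ∀ p q → p * p * (q * q) ≡ (q * p) * (q * p)
    left = solve-∀
    right : ∀ p r u → (p * r) * (p * r) * u ≡ p * p * (r * r * u)
    right = solve-∀

legendre-nonresidue : ∀ a p (prm : Prime p) → legendre a p prm ≡ -1ℤ → ¬ QuadraticResidue a p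
legendre-nonresidue a p prm = by-cases ((+ p) ℤ∣.∣? a) (quadraticResidue? a p {{prime⇒nonZero prm}})
  where
  -- With both decisions abstracted the conditional computes; the values 0 and 1 differ from -1,
  -- which leaves only the case of two negative answers.
  by-cases : ∀ {A B : Set} (A? : Dec A) (B? : Dec B) →
    (if does A? then + 0 else if does B? then + 1 else -1ℤ) ≡ -1ℤ → ¬ B
  by-cases (no _) (no ¬B) _ = ¬B

residue-of-square : ∀ {p a c} x → x * x ≡ c * p + a → QuadraticResidue (+ a) p
residue-of-square {p} {a} {c} x e = + x , ℤ∣.divides (+ c) (begin
  + x ℤ.* + x ℤ.- + a        ≡⟨ cong (ℤ._- + a) (sym (ℤ.pos-* x x)) ⟩
  + (x * x) ℤ.- + a          ≡⟨ cong (λ m → + m ℤ.- + a) e ⟩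
  + (c * p + a) ℤ.- + a      ≡⟨ cong (ℤ._- + a) (ℤ.pos-+ (c * p) a) ⟩
  (+ (c * p) ℤ.+ + a) ℤ.- + a  ≡⟨ ℤ.+-assoc (+ (c * p)) (+ a) (ℤ.- + a) ⟩
  + (c * p) ℤ.+ (+ a ℤ.- + a)  ≡⟨ cong (ℤ._+_ (+ (c * p))) (ℤ.+-inverseʳ (+ a)) ⟩
  + (c * p) ℤ.+ + 0          ≡⟨ ℤ.+-identityʳ _ ⟩
  + (c * p)                  ≡⟨ ℤ.pos-* c p ⟩
  + c ℤ.* + p                ∎)
  where open ≡-Reasoning

-- Since p is odd, p²ᵅ = 1 + 8t, so the numerator is 8(j + (8j + 1)t) and neither `_∸_` nor `_/_`
-- loses anything.
8N+1-factors : ∀ {p} → parity p ≡ 1ℙ → ∀ α n j →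
  8 * (p ^ (2 * α + 1) * n + ((8 * j + 1) * p ^ (2 * α) ∸ 1) / 8) + 1 ≡
  p ^ α * p ^ α * (8 * n * p + (8 * j + 1))
8N+1-factors {p} odd-p α n j with parity-split (p ^ α)
... | inj₁ (even-s , _) = contradiction (trans (sym even-s) (parity-^ odd-p α)) λ ()
... | inj₂ (_ , k , s≡) with t , s²≡ ← odd-square k = begin
  8 * (p ^ (2 * α + 1) * n + ((8 * j + 1) * p ^ (2 * α) ∸ 1) / 8) + 1
    ≡⟨ cong₂ (λ P Q → 8 * (P * n + Q / 8) + 1) odd-power numerator ⟩
  8 * (s * s * p * n + ((j + (8 * j + 1) * t) * 8) / 8) + 1
    ≡⟨ cong (λ Q → 8 * (s * s * p * n + Q) + 1) (m*n/n≡m (j + (8 * j + 1) * t) 8) ⟩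
  8 * (s * s * p * n + (j + (8 * j + 1) * t)) + 1
    ≡⟨ expand (s * s) p n j t ⟩
  s * s * (8 * n * p) + (8 * j + 1) * (1 + t * 8)
    ≡⟨ cong (λ S → s * s * (8 * n * p) + (8 * j + 1) * S) square-s ⟨
  s * s * (8 * n * p) + (8 * j + 1) * (s * s)
    ≡⟨ collect (s * s) (8 * n * p) (8 * j + 1) ⟩
  s * s * (8 * n * p + (8 * j + 1)) ∎
  where
  open ≡-Reasoning
  s : ℕ
  s = p ^ α
  square-s : s * s ≡ 1 + t * 8
  square-s = trans (cong₂ _*_ s≡ s≡) s²≡
  even-power : p ^ (2 * α) ≡ s * s
  even-power = trans (cong (λ β → p ^ (α + β)) (+-identityʳ α)) (^-distribˡ-+-* p α α)
  odd-power : p ^ (2 * α + 1) ≡ s * s * p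
  odd-power = trans (^-distribˡ-+-* p (2 * α) 1) (cong₂ _*_ even-power (*-identityʳ p))
  eighth : ∀ j t → (8 * j + 1) * (1 + t * 8) ≡ suc ((j + (8 * j + 1) * t) * 8)
  eighth = solve-∀
  numerator : (8 * j + 1) * p ^ (2 * α) ∸ 1 ≡ (j + (8 * j + 1) * t) * 8
  numerator = cong (_∸ 1) (trans (cong ((8 * j + 1) *_) (trans even-power square-s)) (eighth j t))
  expand : ∀ S p n j t → 8 * (S * p * n + (j + (8 * j + 1) * t)) + 1 ≡ S * (8 * n * p) + (8 * j + 1) * (1 + t * 8)
  expand = solve-∀
  collect : ∀ S a b → S * a + b * S ≡ S * (a + b)
  collect = solve-∀

theorem3p11 : ∀ (p : ℕ) (prm : Prime p) → p ≢ 2 → ∀ (α n j : ℕ) → j ≤ p ∸ 1 →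
    legendre (+ (8 * j + 1)) p prm ≡ -1ℤ →
    b 4 (p ^ (2 * α + 1) * n + ((8 * j + 1) * p ^ (2 * α) ∸ 1) / 8) % 2 ≡ 0
theorem3p11 p prm p≢2 α n j _ leg = b₄-even N nonSquare
  where
  N : ℕ
  N = p ^ (2 * α + 1) * n + ((8 * j + 1) * p ^ (2 * α) ∸ 1) / 8
  nonSquare : ∀ y → y * y ≢ 8 * N + 1
  -- Removing p²ᵅ from y² leaves x² = 8np + (8j + 1), so 8j + 1 would be a residue.
  nonSquare y y²≡ with x , x²≡ ← square-cofactor prm α y
      (trans y²≡ (8N+1-factors (odd-prime-parity prm p≢2) α n j)) =
    legendre-nonresidue (+ (8 * j + 1)) p prm leg (residue-of-square {c = 8 * n} x x²≡)
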